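{- Let $n,m\ge 5$ be integers with $m\equiv 1\pmod 4$ and $n\equiv 1\pmod 4$. Then $\gamma_t(C_n\times C_m)\le\frac{(n+1)(m+1)}{4}$ and $\gamma_p(C_n\times C_m)\le\frac{(n+1)(m+1)}{4}+1$.
   Context: All graphs are finite, simple and undirected. $C_n$ denotes the cycle of order $n$ and $G\times H$ the Cartesian product of graphs. For a graph $G$ without isolated vertices: a set $D\subseteq V(G)$ is a total dominating set if every vertex of $G$ (including those in $D$) has a neighbour in $D$; $\gamma_t(G)$ is the minimum size of a total dominating set. A set $D\subseteq V(G)$ is a paired dominating set if every vertex outside $D$ has a neighbour in $D$ and the induced subgraph $G[D]$ has a perfect matching; $\gamma_p(G)$ is the minimum size of a paired dominating set. -}

module Defs where

open import Data.Nat.Base using (ℕ; suc; _≤_; s≤s; _*_)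
import Data.Nat.Properties as ℕ
open import Data.Fin.Base using (Fin; zero; suc; toℕ; remQuot)
import Data.Fin.Properties as Fin
open import Data.Fin.Subset using (Subset; inside; outside; _∈_; _∉_; ∣_∣)
open import Data.Vec.Base using ([]; _∷_)
open import Data.Product.Base using (Σ; ∃-syntax; _×_; _,_)
open import Data.Product using (∃!)
open import Data.Sum.Base using (_⊎_; inj₁; inj₂; swap; map)
open import Level using (Level; 0ℓ)
open import Relation.Binary.Core using (Rel)
open import Relation.Binary.Definitions using (Symmetric; Irreflexive; Decidable)
open import Relation.Binary.PropositionalEquality using (_≡_; refl; sym; trans; cong)
open import Relation.Nullary using (¬_)
open import Relation.Nullary.Decidable using (_×-dec_; _⊎-dec_)

record Graph : Set₁ where
  field
    order   : ℕ
    Adj     : Rel (Fin order) 0ℓ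
    Adj?    : Decidable Adj
    symm    : Symmetric Adj
    irrefl  : Irreflexive _≡_ Adj

  Vertex : Set
  Vertex = Fin order

open Graph public

-- j is the cyclic successor of i in 0, 1, …, n - 1.
Next : ∀ {n} → Fin n → Fin n → Set
Next {n} i j = toℕ j ≡ suc (toℕ i) ⊎ (suc (toℕ i) ≡ n × toℕ j ≡ 0)

Next? : ∀ {n} → Decidable (Next {n})
Next? {n} i j =
  (toℕ j ℕ.≟ suc (toℕ i)) ⊎-dec ((suc (toℕ i) ℕ.≟ n) ×-dec (toℕ j ℕ.≟ 0))

Next-irrefl : ∀ {n} → 3 ≤ n → (i : Fin n) → ¬ Next i i
Next-irrefl _                    i (inj₁ p)       = ℕ.1+n≢n (sym p)
Next-irrefl (s≤s (s≤s _))        i (inj₂ (p , q)) with trans (sym p) (cong suc q)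
... | ()

cycle : (n : ℕ) → 3 ≤ n → Graph
cycle n 3≤n = record
  { order  = n
  ; Adj    = λ i j → Next i j ⊎ Next j i
  ; Adj?   = λ i j → Next? i j ⊎-dec Next? j i
  ; symm   = swap
  ; irrefl = λ { {i} refl (inj₁ p) → Next-irrefl 3≤n i p
               ; {i} refl (inj₂ p) → Next-irrefl 3≤n i p }
  }

-- Vertices of the product are pairs, coded by remQuot / combine.
infixr 7 _□_

_□_ : Graph → Graph → Graph
G □ H = record
  { order  = order G * order H
  ; Adj    = λ u v → Adj′ (remQuot (order H) u) (remQuot (order H) v)
  ; Adj?   = λ u v → Adj′? (remQuot (order H) u) (remQuot (order H) v)
  ; symm   = λ {u} {v} → symm′ (remQuot (order H) u) (remQuot (order H) v)
  ; irrefl = λ { {u} refl → irrefl′ (remQuot (order H) u) }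
  }
  where
  Adj′ : Rel (Vertex G × Vertex H) 0ℓ
  Adj′ (a , b) (c , d) = (a ≡ c × Adj H b d) ⊎ (b ≡ d × Adj G a c)

  Adj′? : Decidable Adj′
  Adj′? (a , b) (c , d) =
    ((a Fin.≟ c) ×-dec Adj? H b d) ⊎-dec ((b Fin.≟ d) ×-dec Adj? G a c)

  symm′ : ∀ p q → Adj′ p q → Adj′ q p
  symm′ _ _ = map (λ (e , h) → sym e , symm H h) (λ (e , g) → sym e , symm G g)

  irrefl′ : ∀ p → ¬ Adj′ p p
  irrefl′ _ (inj₁ (_ , h)) = irrefl H refl h
  irrefl′ _ (inj₂ (_ , g)) = irrefl G refl g

-- The elements of D in increasing order.
element : ∀ {n} (D : Subset n) → Fin ∣ D ∣ → Fin n
element (inside  ∷ D) zero    = zero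
element (inside  ∷ D) (suc i) = suc (element D i)
element (outside ∷ D) i       = suc (element D i)

-- G[D], with its vertices renumbered along element.
induced : (G : Graph) → Subset (order G) → Graph
induced G D = record
  { order  = ∣ D ∣
  ; Adj    = λ i j → Adj G (element D i) (element D j)
  ; Adj?   = λ i j → Adj? G (element D i) (element D j)
  ; symm   = symm G
  ; irrefl = λ { refl → irrefl G refl }
  }

-- A set of edges is a symmetric subrelation M of adjacency; it is a perfect
-- matching when every vertex lies on exactly one edge of M.
record IsPerfectMatching (G : Graph) (M : Rel (Vertex G) 0ℓ) : Set where
  field
    edges   : ∀ {u v} → M u v → Adj G u v
    symmM   : Symmetric M
    perfect : ∀ v → ∃! _≡_ (M v)

HasPerfectMatching : Graph → Set₁
HasPerfectMatching G = Σ (Rel (Vertex G) 0ℓ) (IsPerfectMatching G)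

IsTotalDominating : (G : Graph) → Subset (order G) → Set
IsTotalDominating G D = ∀ v → ∃[ u ] u ∈ D × Adj G v u

IsPairedDominating : (G : Graph) → Subset (order G) → Set₁
IsPairedDominating G D =
  (∀ v → v ∉ D → ∃[ u ] u ∈ D × Adj G v u) × HasPerfectMatching (induced G D)

IsMinimumSize : ∀ {n} {ℓ : Level} → (Subset n → Set ℓ) → ℕ → Set ℓ
IsMinimumSize P k = (∃[ D ] P D × ∣ D ∣ ≡ k) × (∀ D → P D → k ≤ ∣ D ∣)

-- γₜ(G) = k and γₚ(G) = k, as relations between G and k: a graph with an
-- isolated vertex has no dominating set of either kind, hence no such k.
IsTotalDominationNumber : Graph → ℕ → Set
IsTotalDominationNumber G = IsMinimumSize (IsTotalDominating G)

IsPairedDominationNumber : Graph → ℕ → Set₁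
IsPairedDominationNumber G = IsMinimumSize (IsPairedDominating G)

{-# OPTIONS --safe #-}

-- Write n = 4a + 1 and m = 4b + 1.  Row 0 and column 0 form a seam; the rest of
-- the torus is cut into 4 × 4 blocks, coloured like a checkerboard and filled by
--
--     . # # .                     . . . .
--     . . . .   (even blocks)     # . . #   (odd blocks)
--     . . . .                     # . . #
--     . # # .                     . . . .
--
-- Repeating the vertical pairs in every row block of the seam column and the
-- horizontal pairs in every column block of the seam row makes the pattern close
-- up whatever the parities of a and b.  Only the corner (0 , 0) is then left
-- undominated.  Adding its neighbour (0 , 1) gives a total dominating set of
-- 4ab + 2a + 2b + 1 vertices; adding the corner as well gives a set which splits
-- into adjacent pairs.
module Submission where

open import Defs
open import Data.Bool.Base using (Bool; true; false; not; _∧_; _∨_; _xor_; if_then_else_)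
open import Data.Bool.Properties
  using (not-involutive; not-distribˡ-xor; not-distribʳ-xor; ∧-conicalˡ; ∧-conicalʳ)
open import Data.Fin.Base
  using (Fin; zero; suc; toℕ; fromℕ<; inject₁; opposite; combine; remQuot; _↑ˡ_; _↑ʳ_;
        finToFun; funToFin)
open import Data.Fin.Patterns using (0F; 1F; 2F; 3F)
open import Data.Fin.Properties
  using (toℕ-combine; toℕ-fromℕ<; toℕ-inject₁; toℕ<n; remQuot-combine; combine-remQuot;
        finToFun-funToFin; opposite-involutive; suc-injective; any?; all?)
  renaming (_≟_ to _≟ᶠ_)
open import Data.Fin.Subset using (Subset; inside; outside; _∈_; ∣_∣)
open import Data.Fin.Subset.Properties using (_∈?_; anySubset?)
open import Data.Nat using (ℕ; zero; suc; _+_; _*_; _/_; _%_; _≤_; _<_; s≤s; _<?_)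
open import Data.Nat.DivMod using (m≡m%n+[m/n]*n; m*n/n≡m)
open import Data.Nat.Induction using (Acc; acc; <-wellFounded)
open import Data.Nat.Properties
  using (≤-trans; m≤m+n; ≤-reflexive; <⇒≤; ≮⇒≥; ≤-antisym; +-assoc;
        +-identityʳ; +-suc; +-0-commutativeMonoid)
open import Algebra.Properties.CommutativeMonoid.Sum +-0-commutativeMonoid
  using (sum; sum-syntax; sum-cong-≗; ∑-distrib-+; ∑-comm)
open import Data.Nat.Tactic.RingSolver using (solve-∀)
open import Data.Product using (_×_; _,_; proj₁; proj₂; ∃-syntax; map; uncurry)
open import Data.Sum using (_⊎_; inj₁; inj₂; swap)
open import Data.Vec.Base using ([]; _∷_; tabulate; lookup; here; there)
open import Data.Vec.Properties using (lookup∘tabulate; []=⇒lookup; lookup⇒[]=)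
open import Function.Base using (_∘_; id)
open import Level using (Level)
open import Relation.Binary.PropositionalEquality
  using (_≡_; refl; sym; trans; cong; cong₂; subst; subst₂; module ≡-Reasoning)
open import Relation.Nullary using (Dec; yes; no)
open import Relation.Nullary.Decidable using (map′; ¬?; _×-dec_; _→-dec_)
open import Relation.Unary using (Decidable)

private
  variable
    a b : ℕ
    ℓ : Level

-- Domination numbers

-- Descent on the size: an exhaustive search over all subsets either finds a strictly smaller set
-- with `P`, which stays below the bound `l`, or shows that the current one is minimum.
minimumSize : ∀ {n l} {P : Subset n → Set ℓ} → Decidable P →
              (D : Subset n) → P D → ∣ D ∣ ≤ l → ∃[ k ] IsMinimumSize P k × k ≤ l
minimumSize {l = l} {P} P? D pD D≤l = go D pD D≤l (<-wellFounded ∣ D ∣)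
  where
  go : ∀ D → P D → ∣ D ∣ ≤ l → Acc _<_ ∣ D ∣ → ∃[ k ] IsMinimumSize P k × k ≤ l
  go D pD D≤l (acc smaller) with anySubset? (λ E → P? E ×-dec (∣ E ∣ <? ∣ D ∣))
  ... | yes (E , pE , E<D) = go E pE (≤-trans (<⇒≤ E<D) D≤l) (smaller E<D)
  ... | no none =
    ∣ D ∣ , ((D , pD , refl) , λ E pE → ≮⇒≥ λ E<D → none (E , pE , E<D)) , D≤l

-- Perfect matchings as involutions

IsPairing : (G : Graph) → (Vertex G → Vertex G) → Set
IsPairing G f = ∀ v → Adj G v (f v) × f (f v) ≡ v

pairing⇒matching : ∀ G f → IsPairing G f → HasPerfectMatching G
pairing⇒matching G f pairing = (λ u v → f u ≡ v) , record
  { edges   = λ { {u} refl → proj₁ (pairing u) }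
  ; symmM   = λ { {u} refl → proj₂ (pairing u) }
  ; perfect = λ v → f v , refl , id
  }

-- By symmetry of `M`, `v` is matched to `partner v`; uniqueness then makes it the partner of
-- `partner v`.
matching⇒pairing : ∀ G → HasPerfectMatching G → ∃[ f ] IsPairing G f
matching⇒pairing G (M , isPM) = partner , λ v →
  edges (matched v) , proj₂ (proj₂ (perfect (partner v))) (symmM (matched v))
  where
  open IsPerfectMatching isPM
  partner = proj₁ ∘ perfect
  matched : ∀ v → M v (partner v)
  matched v = proj₁ (proj₂ (perfect v))

-- Self-maps of the vertex set, unlike relations, have codes in a finite type, so a search over the
-- codes of involutions decides the question.
hasPerfectMatching? : ∀ G → Dec (HasPerfectMatching G)
hasPerfectMatching? G = map′
  (λ (c , pairing) → pairing⇒matching G (finToFun c) pairing)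
  (λ hasPM → let f , pairing = matching⇒pairing G hasPM in
    funToFin f , λ v → recode f v (pairing v))
  (any? λ c → all? λ v → Adj? G v (finToFun c v) ×-dec (finToFun c (finToFun c v) ≟ᶠ v))
  where
  -- Decoding the code of `f` returns `f` pointwise, so both conditions are carried over vertex by
  -- vertex.
  recode : ∀ f v → Adj G v (f v) × f (f v) ≡ v →
           let g = finToFun (funToFin f) in Adj G v (g v) × g (g v) ≡ v
  recode f v (adj , inv) rewrite finToFun-funToFin f v =
    adj , trans (finToFun-funToFin f (f v)) inv

isTotalDominating? : ∀ G → Decidable (IsTotalDominating G)
isTotalDominating? G D = all? λ v → any? λ u → (u ∈? D) ×-dec Adj? G v u

isPairedDominating? : ∀ G → Decidable (IsPairedDominating G)
isPairedDominating? G D =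
  (all? λ v → ¬? (v ∈? D) →-dec any? λ u → (u ∈? D) ×-dec Adj? G v u)
  ×-dec hasPerfectMatching? (induced G D)

element-∈ : ∀ {n} (D : Subset n) i → element D i ∈ D
element-∈ (inside  ∷ D) zero    = here
element-∈ (inside  ∷ D) (suc i) = there (element-∈ D i)
element-∈ (outside ∷ D) i       = there (element-∈ D i)

element-injective : ∀ {n} (D : Subset n) {i j} → element D i ≡ element D j → i ≡ j
element-injective (inside  ∷ D) {zero}  {zero}  _  = refl
element-injective (inside  ∷ D) {suc i} {suc j} eq =
  cong suc (element-injective D (suc-injective eq))
element-injective (outside ∷ D) eq = element-injective D (suc-injective eq)

element-surjective : ∀ {n} (D : Subset n) {v} → v ∈ D → ∃[ i ] element D i ≡ v
element-surjective (inside  ∷ D) here      = zero , refl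
element-surjective (inside  ∷ D) (there p) = map suc (cong suc) (element-surjective D p)
element-surjective (outside ∷ D) (there p) = map id (cong suc) (element-surjective D p)

-- Since `f` maps `D` into itself, it pulls back along the injection `element D`. Its values off `D`
-- are arbitrary.
inducedPairing : ∀ G D (f : Vertex G → Vertex G) →
  (∀ {v} → v ∈ D → f v ∈ D × Adj G v (f v) × f (f v) ≡ v) →
  HasPerfectMatching (induced G D)
inducedPairing G D f onD = pairing⇒matching (induced G D) g λ i →
  subst (Adj G (element D i)) (sym (g-spec i)) (proj₁ (proj₂ (onD (element-∈ D i)))) ,
  element-injective D (begin
    element D (g (g i)) ≡⟨ g-spec (g i) ⟩
    f (element D (g i)) ≡⟨ cong f (g-spec i) ⟩
    f (f (element D i)) ≡⟨ proj₂ (proj₂ (onD (element-∈ D i))) ⟩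
    element D i         ∎)
  where
  open ≡-Reasoning
  image : ∀ i → ∃[ j ] element D j ≡ f (element D i)
  image i = element-surjective D (proj₁ (onD (element-∈ D i)))
  g = proj₁ ∘ image
  g-spec : ∀ i → element D (g i) ≡ f (element D i)
  g-spec = proj₂ ∘ image

-- Coordinates on a cycle of order 4a + 1

-- The seam is vertex 0; position κ of block i is vertex 1 + 4i + κ.
data Coord (a : ℕ) : Set where
  seam : Coord a
  cell : Fin a → Fin 4 → Coord a

⟦_⟧ : Coord a → Fin (suc (a * 4))
⟦ seam ⟧     = zero
⟦ cell i κ ⟧ = suc (combine i κ)

coord : ∀ a → Fin (suc (a * 4)) → Coord a
coord a zero    = seam
coord a (suc x) = uncurry cell (remQuot 4 x)

coord-⟦⟧ : (x : Coord a) → coord a ⟦ x ⟧ ≡ x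
coord-⟦⟧ seam       = refl
coord-⟦⟧ (cell i κ) = cong (uncurry cell) (remQuot-combine i κ)

⟦⟧-coord : (x : Fin (suc (a * 4))) → ⟦ coord a x ⟧ ≡ x
⟦⟧-coord zero        = refl
⟦⟧-coord {a} (suc x) = cong suc (combine-remQuot {a} 4 x)

infix 4 _∼_
_∼_ : Coord a → Coord a → Set
x ∼ y = Next ⟦ x ⟧ ⟦ y ⟧ ⊎ Next ⟦ y ⟧ ⟦ x ⟧

within-block : (i : Fin a) {κ κ′ : Fin 4} → toℕ κ′ ≡ suc (toℕ κ) → cell i κ ∼ cell i κ′
within-block i {κ} {κ′} eq = inj₁ (inj₁ (cong suc (begin
  toℕ (combine i κ′)         ≡⟨ toℕ-combine i κ′ ⟩
  4 * toℕ i + toℕ κ′         ≡⟨ cong (4 * toℕ i +_) eq ⟩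
  4 * toℕ i + suc (toℕ κ)    ≡⟨ +-suc (4 * toℕ i) (toℕ κ) ⟩
  suc (4 * toℕ i + toℕ κ)    ≡⟨ cong suc (toℕ-combine i κ) ⟨
  suc (toℕ (combine i κ))    ∎)))
  where open ≡-Reasoning

between-blocks : {i j : Fin a} → toℕ j ≡ suc (toℕ i) → cell i 3F ∼ cell j 0F
between-blocks {i = i} {j} eq = inj₁ (inj₁ (cong suc (begin
  toℕ (combine j 0F)         ≡⟨ toℕ-combine j 0F ⟩
  4 * toℕ j + 0              ≡⟨ cong (λ x → 4 * x + 0) eq ⟩
  4 * suc (toℕ i) + 0        ≡⟨ rearrange (toℕ i) ⟩
  suc (4 * toℕ i + 3)        ≡⟨ cong suc (toℕ-combine i 3F) ⟨
  suc (toℕ (combine i 3F))   ∎)))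
  where
  open ≡-Reasoning
  rearrange : ∀ x → 4 * suc x + 0 ≡ suc (4 * x + 3)
  rearrange = solve-∀

-- Position 3 of the last block is vertex 4a, the largest one, so the wrap-around clause of `Next`
-- applies.
last∼seam : {i : Fin a} → suc (toℕ i) ≡ a → cell i 3F ∼ seam
last∼seam {a} {i} eq = inj₁ (inj₂ (cong suc (begin
  suc (toℕ (combine i 3F))   ≡⟨ cong suc (toℕ-combine i 3F) ⟩
  suc (4 * toℕ i + 3)        ≡⟨ rearrange (toℕ i) ⟩
  suc (toℕ i) * 4            ≡⟨ cong (_* 4) eq ⟩
  a * 4                      ∎) , refl))
  where
  open ≡-Reasoning
  rearrange : ∀ x → suc (4 * x + 3) ≡ suc x * 4
  rearrange = solve-∀

seam∼first : ∀ a → _∼_ {suc a} seam (cell zero zero)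
seam∼first _ = inj₁ (inj₁ refl)

-- Steps inside a block and across its ends

inner : Fin 4 → Bool
inner 0F = false
inner 1F = true
inner 2F = true
inner 3F = false

odd : ℕ → Bool
odd zero    = false
odd (suc n) = not (odd n)

-- The two inner positions serve each other, as total domination demands of members of the set.
toInner : (i : Fin a) (κ : Fin 4) → ∃[ κ′ ] inner κ′ ≡ true × cell i κ ∼ cell i κ′
toInner i 0F = 1F , refl , within-block i refl
toInner i 1F = 2F , refl , within-block i refl
toInner i 2F = 1F , refl , swap (within-block i refl)
toInner i 3F = 2F , refl , swap (within-block i refl)

toOuter : (i : Fin a) (κ : Fin 4) → inner κ ≡ true →
          ∃[ κ′ ] inner κ′ ≡ false × cell i κ ∼ cell i κ′
toOuter i 1F _ = 0F , refl , swap (within-block i refl)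
toOuter i 2F _ = 3F , refl , within-block i refl
toOuter i 3F ()

-- What can lie beyond an end of block `i`: the seam, or the outer end of a block of the other
-- parity. The seam separates the last block from the first, so their parities are never compared.
data Across (i : Fin a) : Coord a → Set where
  seam : Across i seam
  cell : ∀ j κ → odd (toℕ j) ≡ not (odd (toℕ i)) → inner κ ≡ false → Across i (cell j κ)

across : (i : Fin a) (κ : Fin 4) → inner κ ≡ false → ∃[ x ] Across i x × cell i κ ∼ x
across {suc a} zero 0F _ = seam , seam , swap (seam∼first a)
across (suc i) 0F _ =
  cell (inject₁ i) 3F ,
  -- The present block is `suc i` and the earlier one has number `i`, so the parities agree after a
  -- double negation.
  cell _ _ (trans (cong odd (toℕ-inject₁ i)) (sym (not-involutive _))) refl ,
  swap (between-blocks (cong suc (sym (toℕ-inject₁ i))))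
across _ 1F ()
across _ 2F ()
across {a} i 3F _ with suc (toℕ i) <? a
... | yes next<a =
  cell (fromℕ< next<a) 0F ,
  cell _ _ (cong odd (toℕ-fromℕ< next<a)) refl ,
  between-blocks (toℕ-fromℕ< next<a)
... | no  next≮a = seam , seam , last∼seam (≤-antisym (toℕ<n i) (≮⇒≥ next≮a))

-- The pattern on the torus

Point : ℕ → ℕ → Set
Point a b = Coord a × Coord b

infix 4 _≈_
_≈_ : Point a b → Point a b → Set
(x , y) ≈ (x′ , y′) = (x ≡ x′ × y ∼ y′) ⊎ (y ≡ y′ × x ∼ x′)

board : Fin a → Fin b → Bool
board i j = odd (toℕ i) xor odd (toℕ j)

board-flipˡ : {i i′ : Fin a} (j : Fin b) → odd (toℕ i′) ≡ not (odd (toℕ i)) →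
              board i′ j ≡ not (board i j)
board-flipˡ {i = i} j flips =
  trans (cong (_xor odd (toℕ j)) flips) (sym (not-distribˡ-xor (odd (toℕ i)) _))

board-flipʳ : (i : Fin a) {j j′ : Fin b} → odd (toℕ j′) ≡ not (odd (toℕ j)) →
              board i j′ ≡ not (board i j)
board-flipʳ i flips =
  trans (cong (odd (toℕ i) xor_) flips) (sym (not-distribʳ-xor (odd (toℕ i)) _))

-- The two fillings are transposes of each other, so arguments for odd blocks mirror those for even
-- blocks.
block : Bool → Fin 4 → Fin 4 → Bool
block false ρ κ = not (inner ρ) ∧ inner κ
block true  ρ κ = inner ρ ∧ not (inner κ)

-- Marks the extra vertex (0 , 1), which dominates the corner.
first : Fin b → Fin 4 → Bool
first zero zero = true
first _    _    = false

-- The flag t tells whether the corner belongs to the pattern.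
pattern? : Bool → Point a b → Bool
pattern? t (seam     , seam)     = t
pattern? t (seam     , cell j κ) = inner κ ∨ first j κ
pattern? t (cell i ρ , seam)     = inner ρ
pattern? t (cell i ρ , cell j κ) = block (board i j) ρ κ

-- The corner never serves as a dominator, hence both values of `t` are covered. On the seam, an
-- inner position is always next to the given one. Inside an even block, a vertex in an outer row
-- moves along the row to an inner column, and one in an inner row and inner column moves to an
-- outer row.
dominated : ∀ t (p : Point a (suc b)) → ∃[ q ] pattern? t q ≡ true × p ≈ q
dominated {b = b} t (seam , seam) =
  (seam , cell zero zero) , refl , inj₁ (refl , seam∼first b)
dominated t (seam , cell j κ) with toInner j κ
... | κ′ , in′ , adj = (seam , cell j κ′) , cong (_∨ first j κ′) in′ , inj₁ (refl , adj)
dominated t (cell i ρ , seam) with toInner i ρ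
... | ρ′ , in′ , adj = (cell i ρ′ , seam) , in′ , inj₂ (refl , adj)
dominated t (cell i ρ , cell j κ) =
  inBlock (board i j) refl (inner ρ) refl (inner κ) refl
  where
  Dominator : Set
  Dominator = ∃[ q ] pattern? t q ≡ true × (cell i ρ , cell j κ) ≈ q

  inEven : ∀ i′ ρ′ j′ κ′ → board i′ j′ ≡ false → inner ρ′ ≡ false → inner κ′ ≡ true →
           (cell i ρ , cell j κ) ≈ (cell i′ ρ′ , cell j′ κ′) → Dominator
  inEven i′ ρ′ j′ κ′ even outρ inκ near = (cell i′ ρ′ , cell j′ κ′) , member , near
    where
    member : block (board i′ j′) ρ′ κ′ ≡ true
    member rewrite even | outρ | inκ = refl

  inOdd : ∀ i′ ρ′ j′ κ′ → board i′ j′ ≡ true → inner ρ′ ≡ true → inner κ′ ≡ false →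
          (cell i ρ , cell j κ) ≈ (cell i′ ρ′ , cell j′ κ′) → Dominator
  inOdd i′ ρ′ j′ κ′ isOdd inρ outκ near = (cell i′ ρ′ , cell j′ κ′) , member , near
    where
    member : block (board i′ j′) ρ′ κ′ ≡ true
    member rewrite isOdd | inρ | outκ = refl

  inBlock : ∀ p → board i j ≡ p → ∀ r → inner ρ ≡ r → ∀ c → inner κ ≡ c → Dominator
  inBlock false even false outρ _ _ =
    let κ′ , inκ′ , adj = toInner j κ
    in inEven i ρ j κ′ even outρ inκ′ (inj₁ (refl , adj))
  inBlock false even true inρ true inκ =
    let ρ′ , outρ′ , adj = toOuter i ρ inρ
    in inEven i ρ′ j κ even outρ′ inκ (inj₂ (refl , adj))
  -- These four cells, in inner rows and outer columns, have no neighbour of the pattern in their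
  -- own block. Sideways they meet an odd block, where such cells belong to the pattern, or an inner
  -- position of the seam column.
  inBlock false even true inρ false outκ with across j κ outκ
  ... | _ , seam , adj = (cell i ρ , seam) , inρ , inj₁ (refl , adj)
  ... | _ , cell j′ κ′ flips outκ′ , adj =
    inOdd i ρ j′ κ′ (trans (board-flipʳ i {j} {j′} flips) (cong not even)) inρ outκ′
      (inj₁ (refl , adj))
  inBlock true isOdd _ _ false outκ =
    let ρ′ , inρ′ , adj = toInner i ρ
    in inOdd i ρ′ j κ isOdd inρ′ outκ (inj₂ (refl , adj))
  inBlock true isOdd true inρ true inκ =
    let κ′ , outκ′ , adj = toOuter j κ inκ
    in inOdd i ρ j κ′ isOdd inρ outκ′ (inj₁ (refl , adj))
  inBlock true isOdd false outρ true inκ with across i ρ outρ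
  ... | _ , seam , adj = (seam , cell j κ) , cong (_∨ first j κ) inκ , inj₂ (refl , adj)
  ... | _ , cell i′ ρ′ flips outρ′ , adj =
    inEven i′ ρ′ j κ (trans (board-flipˡ {i = i} {i′} j flips) (cong not isOdd)) outρ′ inκ
      (inj₂ (refl , adj))

-- The pairing of the pattern

seamMate : Fin 4 → Fin (suc b) → Coord (suc b)
seamMate zero    zero    = seam
-- A filler: position 0 of a later block is outside the pattern. The same holds for position 3 in
-- the next clause, whose real content is the exchange of 1 and 2.
seamMate zero    (suc j) = cell (suc j) zero
seamMate (suc κ) j       = cell j (opposite (suc κ))

mate : Point a (suc b) → Point a (suc b)
mate (seam     , seam)     = seam , cell zero zero
mate (seam     , cell j κ) = seam , seamMate κ j
mate (cell i ρ , seam)     = cell i (opposite ρ) , seam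
mate (cell i ρ , cell j κ) =
  if board i j then (cell i (opposite ρ) , cell j κ) else (cell i ρ , cell j (opposite κ))

inner-opposite : (κ : Fin 4) → inner (opposite κ) ≡ inner κ
inner-opposite 0F = refl
inner-opposite 1F = refl
inner-opposite 2F = refl
inner-opposite 3F = refl

opposite-adjacent : (i : Fin a) (κ : Fin 4) → inner κ ≡ true → cell i κ ∼ cell i (opposite κ)
opposite-adjacent i 1F _ = within-block i refl
opposite-adjacent i 2F _ = swap (within-block i refl)
opposite-adjacent i 3F ()

mate-pairs : (p : Point a (suc b)) → pattern? true p ≡ true →
             pattern? true (mate p) ≡ true × p ≈ mate p × mate (mate p) ≡ p
mate-pairs {b = b} (seam , seam) _ = refl , inj₁ (refl , seam∼first b) , refl
mate-pairs {b = b} (seam , cell zero 0F) _ = refl , inj₁ (refl , swap (seam∼first b)) , refl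
mate-pairs (seam , cell j 1F) _ = refl , inj₁ (refl , within-block j refl) , refl
mate-pairs (seam , cell j 2F) _ = refl , inj₁ (refl , swap (within-block j refl)) , refl
-- `first` inspects the block before the position, so position 3 is refuted only after splitting the
-- block.
mate-pairs (seam , cell zero 3F) ()
mate-pairs (seam , cell (suc j) 3F) ()
mate-pairs (cell i ρ , seam) inρ =
  trans (inner-opposite ρ) inρ ,
  inj₂ (refl , opposite-adjacent i ρ inρ) ,
  cong (λ x → cell i x , seam) (opposite-involutive ρ)
mate-pairs (cell i ρ , cell j κ) p∈D with board i j in eq
-- The mate stays in its block, so the same colour decides the second application of `mate`.
... | true rewrite eq =
  trans (cong (_∧ not (inner κ)) (inner-opposite ρ)) p∈D ,
  inj₂ (refl , opposite-adjacent i ρ (∧-conicalˡ _ _ p∈D)) ,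
  cong (λ x → cell i x , cell j κ) (opposite-involutive ρ)
... | false rewrite eq =
  trans (cong (not (inner ρ) ∧_) (inner-opposite κ)) p∈D ,
  inj₁ (refl , opposite-adjacent j κ (∧-conicalʳ _ _ p∈D)) ,
  cong (λ x → cell i ρ , cell j x) (opposite-involutive κ)

-- Counting

indicator : Bool → ℕ
indicator x = if x then 1 else 0

∣tabulate∣ : ∀ {n} (f : Fin n → Bool) → ∣ tabulate f ∣ ≡ sum (indicator ∘ f)
∣tabulate∣ {zero}  f = refl
∣tabulate∣ {suc n} f with f zero
... | true  = cong suc (∣tabulate∣ (f ∘ suc))
... | false = ∣tabulate∣ (f ∘ suc)

sum-split : ∀ m {n} (f : Fin (m + n) → ℕ) → sum f ≡ sum (f ∘ (_↑ˡ n)) + sum (f ∘ (m ↑ʳ_))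
sum-split zero    f = refl
sum-split (suc m) f =
  trans (cong (f zero +_) (sum-split m (f ∘ suc))) (sym (+-assoc (f zero) _ _))

sum-combine : ∀ n k (f : Fin (n * k) → ℕ) →
              sum f ≡ ∑[ i < n ] ∑[ j < k ] f (combine i j)
sum-combine zero    k f = refl
sum-combine (suc n) k f =
  trans (sum-split k f) (cong (sum (f ∘ (_↑ˡ n * k)) +_) (sum-combine n k (f ∘ (k ↑ʳ_))))

sum-remQuot : ∀ n k (f : Fin n × Fin k → ℕ) →
              sum (f ∘ remQuot {n} k) ≡ ∑[ i < n ] ∑[ j < k ] f (i , j)
sum-remQuot n k f = trans (sum-combine n k (f ∘ remQuot k))
  (sum-cong-≗ λ i → sum-cong-≗ λ j → cong f (remQuot-combine i j))

sum-coord : ∀ a (f : Coord a → ℕ) →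
            sum (f ∘ coord a) ≡ f seam + ∑[ i < a ] ∑[ κ < 4 ] f (cell i κ)
sum-coord a f = cong (f seam +_) (sum-remQuot a 4 (f ∘ uncurry cell))

sum-const : ∀ n (f : Fin n → ℕ) k → (∀ i → f i ≡ k) → sum f ≡ n * k
sum-const zero    f k eq = refl
sum-const (suc n) f k eq = cong₂ _+_ (eq zero) (sum-const n (f ∘ suc) k (eq ∘ suc))

count : Bool → Point a b → ℕ
count t = indicator ∘ pattern? t

seamRow-size : ∀ a b t →
  ∑[ y < suc (suc b * 4) ] count {a} t (seam , coord (suc b) y) ≡
  indicator t + (3 + b * 2)
seamRow-size a b t = trans (sum-coord (suc b) (λ y → count {a} t (seam , y)))
  -- Block 0 holds its pair and the extra vertex, the other `b` blocks a pair each.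
  (cong (λ x → indicator t + (3 + x)) (sum-const b _ 2 λ _ → refl))

row-size : ∀ {a b} t (i : Fin a) ρ →
  ∑[ y < suc (b * 4) ] count {a} {b} t (cell i ρ , coord b y) ≡
  indicator (inner ρ) + ∑[ j < b ] ∑[ κ < 4 ] indicator (block (board i j) ρ κ)
row-size {a} {b} t i ρ = sum-coord b (λ y → count t (cell i ρ , y))

-- Both colours hold four vertices, so the parities drop out of the count.
block-size : ∀ p → ∑[ ρ < 4 ] ∑[ κ < 4 ] indicator (block p ρ κ) ≡ 4
block-size false = refl
block-size true  = refl

rowBlock-size : ∀ {a b} t (i : Fin a) →
  ∑[ ρ < 4 ] ∑[ y < suc (b * 4) ] count {a} {b} t (cell i ρ , coord b y) ≡ 2 + b * 4
rowBlock-size {a} {b} t i = begin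
  ∑[ ρ < 4 ] ∑[ y < suc (b * 4) ] count {a} {b} t (cell i ρ , coord b y)
    ≡⟨ sum-cong-≗ (row-size {b = b} t i) ⟩
  ∑[ ρ < 4 ] (indicator (inner ρ) + ∑[ j < b ] cells ρ j)
    ≡⟨ ∑-distrib-+ (indicator ∘ inner) (λ ρ → ∑[ j < b ] cells ρ j) ⟩
  2 + ∑[ ρ < 4 ] ∑[ j < b ] cells ρ j
    -- A single row of a block has a size depending on the colour; only whole blocks are constant,
    -- so blocks are summed first.
    ≡⟨ cong (2 +_) (∑-comm cells) ⟩
  2 + ∑[ j < b ] ∑[ ρ < 4 ] cells ρ j
    ≡⟨ cong (2 +_) (sum-const b _ 4 (λ j → block-size (board i j))) ⟩
  2 + b * 4 ∎
  where
  open ≡-Reasoning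
  cells : Fin 4 → Fin b → ℕ
  cells ρ j = ∑[ κ < 4 ] indicator (block (board i j) ρ κ)

-- The pattern as a vertex set of the product of two cycles

module Torus (a b : ℕ) (3≤n : 3 ≤ suc (a * 4)) (3≤m : 3 ≤ suc (suc b * 4)) where

  n m : ℕ
  n = suc (a * 4)
  m = suc (suc b * 4)

  G : Graph
  G = cycle n 3≤n □ cycle m 3≤m

  vertex : Point a (suc b) → Vertex G
  vertex (x , y) = combine ⟦ x ⟧ ⟦ y ⟧

  point : Vertex G → Point a (suc b)
  point v = map (coord a) (coord (suc b)) (remQuot {n} m v)

  point-vertex : ∀ p → point (vertex p) ≡ p
  point-vertex (x , y) = trans
    (cong (map (coord a) (coord (suc b))) (remQuot-combine ⟦ x ⟧ ⟦ y ⟧))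
    (cong₂ _,_ (coord-⟦⟧ x) (coord-⟦⟧ y))

  vertex-point : ∀ v → vertex (point v) ≡ v
  vertex-point v =
    let x , y = remQuot {n} m v
    in trans (cong₂ combine (⟦⟧-coord {a} x) (⟦⟧-coord {suc b} y)) (combine-remQuot {n} m v)

  ≈⇒Adj : ∀ p q → p ≈ q → Adj G (vertex p) (vertex q)
  ≈⇒Adj (x , y) (x′ , y′) p≈q =
    subst₂ Adj′ (sym (remQuot-combine ⟦ x ⟧ ⟦ y ⟧)) (sym (remQuot-combine ⟦ x′ ⟧ ⟦ y′ ⟧))
      (step p≈q)
    where
    -- Adjacency of the product on uncoded pairs, as the motive of the transport along
    -- `remQuot-combine`.
    Adj′ : Fin n × Fin m → Fin n × Fin m → Set
    Adj′ (i , j) (k , l) = (i ≡ k × Adj (cycle m 3≤m) j l) ⊎ (j ≡ l × Adj (cycle n 3≤n) i k)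
    step : (x , y) ≈ (x′ , y′) → Adj′ (⟦ x ⟧ , ⟦ y ⟧) (⟦ x′ ⟧ , ⟦ y′ ⟧)
    step (inj₁ (refl , y∼y′)) = inj₁ (refl , y∼y′)
    step (inj₂ (refl , x∼x′)) = inj₂ (refl , x∼x′)

  D : Bool → Subset (order G)
  D t = tabulate (pattern? t ∘ point)

  ∈D⇒pattern : ∀ t {v} → v ∈ D t → pattern? t (point v) ≡ true
  ∈D⇒pattern t {v} v∈D = trans (sym (lookup∘tabulate (pattern? t ∘ point) v)) ([]=⇒lookup v∈D)

  pattern⇒∈D : ∀ t p → pattern? t p ≡ true → vertex p ∈ D t
  pattern⇒∈D t p eq = lookup⇒[]= (vertex p) (D t) (begin
    lookup (D t) (vertex p)        ≡⟨ lookup∘tabulate (pattern? t ∘ point) (vertex p) ⟩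
    pattern? t (point (vertex p))  ≡⟨ cong (pattern? t) (point-vertex p) ⟩
    pattern? t p                   ≡⟨ eq ⟩
    true                           ∎)
    where open ≡-Reasoning

  ≈point⇒Adj : ∀ v q → point v ≈ q → Adj G v (vertex q)
  ≈point⇒Adj v q v≈q =
    subst (λ u → Adj G u (vertex q)) (vertex-point v) (≈⇒Adj (point v) q v≈q)

  totalDominating : ∀ t → IsTotalDominating G (D t)
  totalDominating t v =
    let q , q∈D , v≈q = dominated t (point v)
    in vertex q , pattern⇒∈D t q q∈D , ≈point⇒Adj v q v≈q

  partner : Vertex G → Vertex G
  partner = vertex ∘ mate ∘ point

  partner-involutive : ∀ v → mate (mate (point v)) ≡ point v → partner (partner v) ≡ v
  partner-involutive v inv = begin
    partner (partner v)            ≡⟨ cong (vertex ∘ mate) (point-vertex (mate (point v))) ⟩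
    vertex (mate (mate (point v))) ≡⟨ cong vertex inv ⟩
    vertex (point v)               ≡⟨ vertex-point v ⟩
    v                              ∎
    where open ≡-Reasoning

  partner-pairs : ∀ {v} → v ∈ D true →
                  partner v ∈ D true × Adj G v (partner v) × partner (partner v) ≡ v
  partner-pairs {v} v∈D =
    let mate∈D , v≈mate , inv = mate-pairs (point v) (∈D⇒pattern true v∈D)
    in pattern⇒∈D true (mate (point v)) mate∈D ,
       ≈point⇒Adj v (mate (point v)) v≈mate ,
       partner-involutive v inv

  pairedDominating : IsPairedDominating G (D true)
  pairedDominating =
    (λ v _ → totalDominating true v) , inducedPairing G (D true) partner partner-pairs

  ∣D∣ : ∀ t → ∣ D t ∣ ≡ (n + 1) * (m + 1) / 4 + indicator t
  ∣D∣ t = begin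
    ∣ D t ∣
      ≡⟨ ∣tabulate∣ (pattern? t ∘ point) ⟩
    sum (count t ∘ point)
      ≡⟨ sum-remQuot n m (count t ∘ map (coord a) (coord (suc b))) ⟩
    ∑[ x < n ] row (coord a x)
      ≡⟨ sum-coord a row ⟩
    row seam + ∑[ i < a ] ∑[ ρ < 4 ] row (cell i ρ)
      ≡⟨ cong₂ _+_ (seamRow-size a b t)
                   (sum-const a _ (2 + suc b * 4) (rowBlock-size {b = suc b} t)) ⟩
    indicator t + (3 + b * 2) + a * (2 + suc b * 4)
      ≡⟨ rearrange a b (indicator t) ⟩
    -- The factors are (n + 1) / 2 and (m + 1) / 2, so the division by 4 is exact.
    (2 * a + 1) * (2 * b + 3) + indicator t
      ≡⟨ cong (_+ indicator t) (m*n/n≡m ((2 * a + 1) * (2 * b + 3)) 4) ⟨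
    (2 * a + 1) * (2 * b + 3) * 4 / 4 + indicator t
      ≡⟨ cong (λ x → x / 4 + indicator t) (quadruple a b) ⟩
    (n + 1) * (m + 1) / 4 + indicator t ∎
    where
    open ≡-Reasoning
    row : Coord a → ℕ
    row x = ∑[ y < m ] count t (x , coord (suc b) y)
    rearrange : ∀ a b s →
      s + (3 + b * 2) + a * (2 + suc b * 4) ≡ (2 * a + 1) * (2 * b + 3) + s
    rearrange = solve-∀
    quadruple : ∀ a b →
      (2 * a + 1) * (2 * b + 3) * 4 ≡ (suc (a * 4) + 1) * (suc (suc b * 4) + 1)
    quadruple = solve-∀

  total : ∃[ k ] IsTotalDominationNumber G k × k ≤ (n + 1) * (m + 1) / 4
  total = minimumSize (isTotalDominating? G) (D false) (totalDominating false)
    (≤-reflexive (trans (∣D∣ false) (+-identityʳ _)))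

  paired : ∃[ k ] IsPairedDominationNumber G k × k ≤ (n + 1) * (m + 1) / 4 + 1
  paired = minimumSize (isPairedDominating? G) (D true) pairedDominating
    (≤-reflexive (∣D∣ true))

-- The orders enter through equations, so that matching on `refl` puts the block form into the graph
-- itself.
domination-numbers : ∀ a b n m (3≤n : 3 ≤ n) (3≤m : 3 ≤ m) →
  n ≡ suc (a * 4) → m ≡ suc (b * 4) →
  let G = cycle n 3≤n □ cycle m 3≤m in
  (∃[ k ] IsTotalDominationNumber G k × k ≤ (n + 1) * (m + 1) / 4)
  × (∃[ k ] IsPairedDominationNumber G k × k ≤ (n + 1) * (m + 1) / 4 + 1)
-- Without column blocks `m` would be 1; otherwise a first column block exists and contains (0 , 1).
domination-numbers a zero    n m 3≤n (s≤s ()) eq refl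
domination-numbers a (suc b) n m 3≤n 3≤m refl refl = total , paired
  where open Torus a b 3≤n 3≤m

theorem5p3 : (n m : ℕ) (5≤n : 5 ≤ n) (5≤m : 5 ≤ m) → m % 4 ≡ 1 → n % 4 ≡ 1 →
    let G = cycle n (≤-trans (m≤m+n 3 2) 5≤n) □ cycle m (≤-trans (m≤m+n 3 2) 5≤m) in
    (∃[ k ] IsTotalDominationNumber G k × k ≤ (n + 1) * (m + 1) / 4)
    × (∃[ k ] IsPairedDominationNumber G k × k ≤ (n + 1) * (m + 1) / 4 + 1)
theorem5p3 n m 5≤n 5≤m m%4≡1 n%4≡1 =
  domination-numbers (n / 4) (m / 4) n m
    (≤-trans (m≤m+n 3 2) 5≤n) (≤-trans (m≤m+n 3 2) 5≤m)
    (decompose n n%4≡1) (decompose m m%4≡1)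
  where
  decompose : ∀ k → k % 4 ≡ 1 → k ≡ suc (k / 4 * 4)
  decompose k k%4≡1 = trans (m≡m%n+[m/n]*n k 4) (cong (_+ k / 4 * 4) k%4≡1)
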